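{- Let $A$ be a finite alphabet. For all sentences $I,J$ over $A$, the product of two fundamental coloured quasi-symmetric functions in $\mathrm{QSym}_A$ is $$F_I\cdot F_J=\sum_K F_K,$$ where the sum is over the sentences $K$ that are summands (counted with multiplicity) of the fundamental shuffle $I\star_F J$.
   Context: $\Bbbk$ is a field of characteristic zero. A sentence $I=(w_1,\dots,w_m)$ over $A$ is a finite sequence of non-empty words in letters of $A$; $1$ is the empty sentence; its maximal word is $w(I)=w_1w_2\cdots w_m$. Write $J\preccurlyeq I$ ($J$ refines $I$) if the words of $I$ can be obtained by concatenating adjacent words of $J$. $\mathrm{QSym}_A$ is the Hopf algebra over $\Bbbk$ with linear basis $(M_I)$ indexed by sentences over $A$, where $M_IM_J=\sum_K M_K$ with $K$ running over the summands (with multiplicity) of the quasi-shuffle $I*J$. The quasi-shuffle is defined recursively by $I*1=1*I=I$ and $((u)\cdot I)*((v)\cdot J)=(u)\cdot(I*((v)\cdot J))+(v)\cdot(((u)\cdot I)*J)+(uv)\cdot(I*J)$ for non-empty words $u,v$, where $\cdot$ is concatenation of sentences. The fundamental functions are $F_I=\sum_{J\preccurlyeq I}M_J$. Fundamental shuffle $I\star_F J$: (1) take the ordinary shuffle of the letters of the maximal words $w(I)$ and $w(J)$, i.e. the formal sum of all $\binom{|w(I)|+|w(J)|}{|w(I)|}$ interleavings (counted with multiplicity, remembering from which word of which sentence each letter comes), each viewed as a sentence of one-letter words; (2) in each summand concatenate neighbouring letters coming from the same word of $I$, and neighbouring letters coming from the same word of $J$; (3) then concatenate pairs of neighbouring subwords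 consisting of a subword of a word of $I$ followed by a subword of a word of $J$ (in this order). Equivalently, in an interleaving $c_1c_2\cdots c_n$ there is no word separation between $c_p$ and $c_{p+1}$ exactly when both come from the same word of $I$, or both come from the same word of $J$, or $c_p$ comes from $I$ and $c_{p+1}$ comes from $J$. For example, $(ab)\star_F(c,d)=(abc,d)+(ac,bd)+(ac,d,b)+(c,abd)+(c,ad,b)+(c,d,ab)$. -}

module Defs where

open import Level using (Level; _⊔_)
open import Algebra.Apartness.Bundles using (HeytingField; HeytingCommutativeRing)
import Algebra.Definitions.RawMonoid as RawMonoidDefs
open import Algebra.Bundles using (CommutativeRing)
open import Data.Bool.Base using (Bool; true; false; if_then_else_)
open import Data.Fin.Base using (Fin)
open import Data.Fin.Properties using (inj⇒≟)
open import Data.List.Base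
  using (List; []; _∷_; _++_; map; concatMap; cartesianProductWith)
import Data.List.Properties as List
open import Data.List.Membership.Propositional using (_∈_)
open import Data.List.Membership.Propositional.Properties
  using ( ∈-++⁺ˡ; ∈-++⁺ʳ; ∈-++⁻; ∈-map⁺; ∈-map⁻
        ; ∈-cartesianProductWith⁺; ∈-cartesianProductWith⁻ )
open import Data.List.NonEmpty.Base as List⁺ using (List⁺; _∷_; _∷⁺_; toList)
open import Data.List.Relation.Unary.Any using (here; there)
open import Data.List.Relation.Unary.Unique.Propositional using (Unique; []; _∷_)
import Data.List.Relation.Unary.All as All
import Data.List.Relation.Unary.Unique.Propositional.Properties as Unique
open import Data.Nat.Base using (ℕ; suc; _≡ᵇ_)
open import Data.Product.Base using (∃; _×_; _,_)
open import Data.Sum.Base using (_⊎_; inj₁; inj₂)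
open import Function.Base using (_∘_)
open import Function.Bundles using (_↔_; _⇔_; mk⇔)
open import Function.Properties.Inverse using (↔⇒↣)
open import Relation.Binary.Definitions using (DecidableEquality)
open import Relation.Binary.PropositionalEquality.Core
  using (_≡_; _≢_; refl; sym; trans; cong)
open import Relation.Nullary.Decidable using (does; map′)
open import Relation.Nullary.Negation using (¬_; contradiction)

private
  variable
    a b c ℓ₁ ℓ₂ : Level
    A : Set a

Word : Set a → Set a
Word = List⁺

Sentence : Set a → Set a
Sentence A = List (Word A)

maximalWord : Sentence A → List A
maximalWord = concatMap toList

infix 4 _≼_

-- G records how the words of J are grouped into the words of I.
_≼_ : {A : Set a} → Sentence A → Sentence A → Set a
_≼_ {A = A} J I = ∃ λ (G : List (List⁺ (Word A))) →
  concatMap toList G ≡ J × map List⁺.concat G ≡ I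

-- Prepends a letter to the first word.
attach : A → Sentence A → Sentence A
attach x []      = (x ∷ []) ∷ []
attach x (w ∷ I) = (x ∷⁺ w) ∷ I

splits : A → List A → List (Sentence A)
splits x []       = ((x ∷ []) ∷ []) ∷ []
splits x (y ∷ ys) =
  map ((x ∷ []) ∷_) (splits y ys) ++ map (attach x) (splits y ys)

-- The sentences J ≼ I, each listed once: see ∈-refinements and
-- refinements-unique.
refinements : Sentence A → List (Sentence A)
refinements []             = [] ∷ []
refinements ((x ∷ xs) ∷ I) =
  cartesianProductWith _++_ (splits x xs) (refinements I)

splits-sound : ∀ (x : A) xs {J} → J ∈ splits x xs → maximalWord J ≡ x ∷ xs
splits-sound x []       (here refl) = refl
splits-sound x (y ∷ ys) J∈ with ∈-++⁻ (map ((x ∷ []) ∷_) (splits y ys)) J∈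
... | inj₁ J∈ˡ with ∈-map⁻ ((x ∷ []) ∷_) J∈ˡ
...   | K , K∈ , refl = cong (x ∷_) (splits-sound y ys K∈)
splits-sound x (y ∷ ys) J∈ | inj₂ J∈ʳ with ∈-map⁻ (attach x) J∈ʳ
...   | []    , K∈ , refl = contradiction (splits-sound y ys K∈) λ ()
...   | _ ∷ _ , K∈ , refl = cong (x ∷_) (splits-sound y ys K∈)

splits-complete : ∀ (x : A) xs J → maximalWord J ≡ x ∷ xs → J ∈ splits x xs
splits-complete x []       ((_ ∷ []) ∷ [])            refl = here refl
splits-complete x (y ∷ ys) ((_ ∷ []) ∷ J)             eq
  with refl , eq′ ← List.∷-injective eq =
  ∈-++⁺ˡ (∈-map⁺ ((x ∷ []) ∷_) (splits-complete y ys J eq′))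
splits-complete x (y ∷ ys) ((_ ∷ z ∷ zs) ∷ J)         eq
  with refl , eq′ ← List.∷-injective eq =
  ∈-++⁺ʳ (map ((x ∷ []) ∷_) (splits y ys))
    (∈-map⁺ (attach x) (splits-complete y ys ((z ∷ zs) ∷ J) eq′))

private

  maximalWord-concat : (g : List⁺ (Word A)) →
    maximalWord (toList g) ≡ toList (List⁺.concat g)
  maximalWord-concat (_ ∷ _) = refl

  toList-injective : {v w : List⁺ A} → toList v ≡ toList w → v ≡ w
  toList-injective refl = refl

  refinements-sound : ∀ (I : Sentence A) {J} → J ∈ refinements I → J ≼ I
  refinements-sound []             (here refl) = [] , refl , refl
  refinements-sound ((x ∷ xs) ∷ I) J∈
    with ∈-cartesianProductWith⁻ _++_ (splits x xs) (refinements I) J∈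
  ... | [] , _ , K∈ , _ , _ = contradiction (splits-sound x xs K∈) λ ()
  ... | u ∷ K , L , K∈ , L∈ , refl with refinements-sound I L∈
  ...   | G , refl , refl = (u ∷ K) ∷ G , refl ,
          cong (_∷ _) (toList-injective (splits-sound x xs K∈))

  refinements-complete : ∀ (G : List (List⁺ (Word A))) →
    concatMap toList G ∈ refinements (map List⁺.concat G)
  refinements-complete []      = here refl
  refinements-complete (g ∷ G) = ∈-cartesianProductWith⁺ _++_
    (splits-complete _ _ (toList g) (maximalWord-concat g))
    (refinements-complete G)

  singleton≢attach : ∀ (x : A) I {J} → J ≢ [] → (x ∷ []) ∷ J ≢ attach x I
  singleton≢attach x [] J≢[] refl = J≢[] refl

  attach-injective : ∀ (x : A) I J → attach x I ≡ attach x J → I ≡ J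
  attach-injective x []      []      _    = refl
  attach-injective x (_ ∷ _) (_ ∷ _) refl = refl

  splits-unique : ∀ (x : A) xs → Unique (splits x xs)
  splits-unique x []       = All.[] ∷ []
  splits-unique x (y ∷ ys) = Unique.++⁺
    (Unique.map⁺ List.∷-injectiveʳ (splits-unique y ys))
    (Unique.map⁺ (attach-injective x _ _) (splits-unique y ys))
    disjoint
    where
    disjoint : ∀ {J} →
      ¬ (J ∈ map ((x ∷ []) ∷_) (splits y ys) × J ∈ map (attach x) (splits y ys))
    disjoint (J∈ˡ , J∈ʳ)
      with K , K∈ , refl ← ∈-map⁻ ((x ∷ []) ∷_) J∈ˡ
         | L , _  , eq   ← ∈-map⁻ (attach x) J∈ʳ =
      singleton≢attach x L (λ { refl → contradiction (splits-sound y ys K∈) λ () }) eq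

  ++-injectiveˡ : ∀ (I J : Sentence A) {K L} → maximalWord I ≡ maximalWord J →
    I ++ K ≡ J ++ L → I ≡ J
  ++-injectiveˡ []      []      _ _  = refl
  ++-injectiveˡ (u ∷ I) (v ∷ J) p eq with refl , eq′ ← List.∷-injective eq =
    cong (u ∷_) (++-injectiveˡ I J (List.++-cancelˡ (toList u) _ _ p) eq′)

  product-unique : ∀ {w : List A} (Is Js : List (Sentence A)) →
    (∀ {I} → I ∈ Is → maximalWord I ≡ w) → Unique Is → Unique Js →
    Unique (cartesianProductWith _++_ Is Js)
  product-unique []       Js _   _          _  = []
  product-unique (I ∷ Is) Js eqs (I∉ ∷ Is!) Js! = Unique.++⁺
    (Unique.map⁺ (List.++-cancelˡ I _ _) Js!)
    (product-unique Is Js (eqs ∘ there) Is! Js!)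
    disjoint
    where
    disjoint : ∀ {K} →
      ¬ (K ∈ map (I ++_) Js × K ∈ cartesianProductWith _++_ Is Js)
    disjoint (K∈ˡ , K∈ʳ)
      with _ , _ , refl ← ∈-map⁻ (I ++_) K∈ˡ
         | I′ , _ , I′∈ , _ , eq ← ∈-cartesianProductWith⁻ _++_ Is Js K∈ʳ =
      All.lookup I∉ I′∈
        (++-injectiveˡ I I′ (trans (eqs (here refl)) (sym (eqs (there I′∈)))) eq)

∈-refinements : {I J : Sentence A} → J ∈ refinements I ⇔ J ≼ I
∈-refinements {I = I} = mk⇔ (refinements-sound I)
  λ { (G , refl , refl) → refinements-complete G }

refinements-unique : (I : Sentence A) → Unique (refinements I)
refinements-unique []             = All.[] ∷ []
refinements-unique ((x ∷ xs) ∷ I) = product-unique (splits x xs) (refinements I)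
  (splits-sound x xs) (splits-unique x xs) (refinements-unique I)

-- A formal sum of sentences with natural multiplicities is a list in
-- which a summand occurs as often as its multiplicity.

infixl 7 _∗_ _⋆_

_∗_ : Sentence A → Sentence A → List (Sentence A)
[]      ∗ J       = J ∷ []
(u ∷ I) ∗ []      = (u ∷ I) ∷ []
(u ∷ I) ∗ (v ∷ J) =
  map (u ∷_) (I ∗ (v ∷ J)) ++
  map (v ∷_) ((u ∷ I) ∗ J) ++
  map ((u List⁺.⁺++⁺ v) ∷_) (I ∗ J)

interleavings : List A → List A → List (List A)
interleavings []       ys       = ys ∷ []
interleavings (x ∷ xs) []       = (x ∷ xs) ∷ []
interleavings (x ∷ xs) (y ∷ ys) =
  map (x ∷_) (interleavings xs (y ∷ ys)) ++
  map (y ∷_) (interleavings (x ∷ xs) ys)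

-- In the fundamental shuffle I ⋆ J, a letter with origin inj₁ i
-- comes from the i-th word of I, and one with origin inj₂ j from the
-- j-th word of J.
Origin : Set
Origin = ℕ ⊎ ℕ

-- The letters of the maximal word, each paired with the index of the
-- word containing it; indices start at k.
indexedLetters : ℕ → Sentence A → List (ℕ × A)
indexedLetters k []      = []
indexedLetters k (u ∷ I) = map (k ,_) (toList u) ++ indexedLetters (suc k) I

-- Whether neighbouring letters with the given origins, in this order,
-- belong to the same word.
glued : Origin → Origin → Bool
glued (inj₁ i) (inj₁ j) = i ≡ᵇ j
glued (inj₂ i) (inj₂ j) = i ≡ᵇ j
glued (inj₁ _) (inj₂ _) = true
glued (inj₂ _) (inj₁ _) = false

glue : List (Origin × A) → Sentence A
glue []                             = []
glue ((_ , x) ∷ [])                 = (x ∷ []) ∷ []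
glue ((p , x) ∷ cs@((q , _) ∷ _)) =
  if glued p q then attach x (glue cs) else (x ∷ []) ∷ glue cs

_⋆_ : Sentence A → Sentence A → List (Sentence A)
I ⋆ J = map glue (interleavings
  (map (λ (i , x) → inj₁ i , x) (indexedLetters 0 I))
  (map (λ (j , x) → inj₂ j , x) (indexedLetters 0 J)))

_ : (a b c d : A) →
  ((a ∷ b ∷ []) ∷ []) ⋆ ((c ∷ []) ∷ (d ∷ []) ∷ []) ≡
    ((a ∷ b ∷ c ∷ []) ∷ (d ∷ [])         ∷ []) ∷
    ((a ∷ c ∷ [])     ∷ (b ∷ d ∷ [])     ∷ []) ∷
    ((a ∷ c ∷ [])     ∷ (d ∷ []) ∷ (b ∷ []) ∷ []) ∷
    ((c ∷ [])         ∷ (a ∷ b ∷ d ∷ []) ∷ []) ∷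
    ((c ∷ [])         ∷ (a ∷ d ∷ []) ∷ (b ∷ []) ∷ []) ∷
    ((c ∷ [])         ∷ (d ∷ []) ∷ (a ∷ b ∷ []) ∷ []) ∷ []
_ = λ _ _ _ _ → refl

CharacteristicZero : HeytingField c ℓ₁ ℓ₂ → Set ℓ₁
CharacteristicZero 𝕜 = ∀ n → ¬ (suc n ×ₙ 1# ≈ 0#)
  where
  open HeytingField 𝕜 using (_≈_; 0#; 1#; heytingCommutativeRing)
  open HeytingCommutativeRing heytingCommutativeRing using (commutativeRing)
  open RawMonoidDefs (CommutativeRing.+-rawMonoid commutativeRing) using ()
    renaming (_×_ to _×ₙ_)

-- QSym_A is realised as the free 𝕜-module on the symbols M I, with the
-- bilinear extension of the quasi-shuffle as its product.

module ColouredQSym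
  {A : Set a} {n : ℕ} (A↔Fin : A ↔ Fin n) (𝕜 : HeytingField c ℓ₁ ℓ₂)
  where

  private
    module 𝕜 = HeytingField 𝕜

  infix 4 _≟_

  _≟_ : DecidableEquality (Sentence A)
  _≟_ = List.≡-dec λ v w → map′ toList-injective (cong toList)
    (List.≡-dec (inj⇒≟ (↔⇒↣ A↔Fin)) (toList v) (toList w))

  -- Unnormalised linear combinations of basis elements. Their equality
  -- is _≈_, not _≡_.
  QSym : Set (a ⊔ c)
  QSym = List (𝕜.Carrier × Sentence A)

  coefficient : QSym → Sentence A → 𝕜.Carrier
  coefficient []            K = 𝕜.0#
  coefficient ((s , I) ∷ x) K =
    (if does (I ≟ K) then s else 𝕜.0#) 𝕜.+ coefficient x K

  infix 4 _≈_

  _≈_ : QSym → QSym → Set (a ⊔ ℓ₁)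
  x ≈ y = ∀ K → coefficient x K 𝕜.≈ coefficient y K

  ∑ : {X : Set b} → List X → (X → QSym) → QSym
  ∑ is f = concatMap f is

  infixr 8 _•_
  infixl 7 _·_

  _•_ : 𝕜.Carrier → QSym → QSym
  s • x = map (λ (t , I) → s 𝕜.* t , I) x

  M : Sentence A → QSym
  M I = (𝕜.1# , I) ∷ []

  _·_ : QSym → QSym → QSym
  x · y = ∑ x λ (s , I) → ∑ y λ (t , J) → (s 𝕜.* t) • ∑ (I ∗ J) M

  F : Sentence A → QSym
  F I = ∑ (refinements I) M

{-# OPTIONS --safe #-}

-- Write F_I as the sum of M_J over all J obtained from the letters of I by
-- cutting everywhere between different words and optionally inside words.
-- Both sides of the identity then become sums over lists of letters, and it
-- suffices to compare these sums as multisets.  A term of the quasi-shuffle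
-- product begins with u, with v, or with uv, where u and v are initial blocks
-- of I and J; u and uv together are the terms whose first letter comes from I.
-- Splitting interleavings by the origin of the first letter therefore gives
-- the same recursion on both sides: the first letter is either a block of its
-- own, or it is attached to the first block of the remaining letters, which
-- after a letter of I is allowed before every letter of J.

module Submission where

open import Defs
open import Algebra.Apartness.Bundles using (HeytingField; HeytingCommutativeRing)
open import Algebra.Bundles using (CommutativeMonoid; CommutativeRing)
import Algebra.Properties.CommutativeSemigroup as CommutativeSemigroupProperties
open import Data.Bool.Base using (Bool; true; false; if_then_else_; T)
open import Data.Bool.Properties using (if-float)
open import Data.Fin.Base using (Fin)
open import Data.List.Base
  using (List; []; _∷_; _++_; map; concat; concatMap; cartesianProductWith)
import Data.List.Properties as List
open import Data.List.NonEmpty.Base using (_∷_; _⁺++⁺_)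
open import Data.List.Relation.Binary.Permutation.Propositional
  using ( _↭_; refl; prep; swap; trans; ↭-refl; ↭-reflexive; ↭-sym; ↭-trans
        ; module PermutationReasoning )
import Data.List.Relation.Binary.Permutation.Propositional.Properties as Perm
open import Data.List.Relation.Unary.All as All using (All; []; _∷_)
import Data.List.Relation.Unary.All.Properties as All
open import Data.Nat.Base using (ℕ; zero; suc; _≡ᵇ_)
open import Data.Product.Base using (_×_; _,_; map₁; proj₁)
open import Data.Sum.Base using (inj₁; inj₂)
open import Function.Base using (_∘_)
open import Function.Bundles using (_↔_)
open import Level using (Level)
open import Relation.Binary.PropositionalEquality
  using (_≡_; _≢_; refl; sym; cong; cong₂; module ≡-Reasoning)
  renaming (trans to ≡-trans)
import Relation.Binary.Reasoning.Setoid as SetoidReasoning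
open import Relation.Nullary.Decidable using (does)

private
  variable
    a b : Level
    A B C : Set a

-- Lists and permutations.

concatMap-concatMap : (g : B → List C) (f : A → List B) (xs : List A) →
  concatMap g (concatMap f xs) ≡ concatMap (concatMap g ∘ f) xs
concatMap-concatMap g f []       = refl
concatMap-concatMap g f (x ∷ xs) = ≡-trans
  (List.concatMap-++ g (f x) (concatMap f xs))
  (cong (concatMap g (f x) ++_) (concatMap-concatMap g f xs))

concatMap-[] : (xs : List A) → concatMap {B = B} (λ _ → []) xs ≡ []
concatMap-[] []       = refl
concatMap-[] (_ ∷ xs) = concatMap-[] xs

++-interchange : (ws xs ys zs : List A) →
  (ws ++ xs) ++ (ys ++ zs) ↭ (ws ++ ys) ++ (xs ++ zs)
++-interchange = interchange
  where
  open CommutativeSemigroupProperties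
    (CommutativeMonoid.commutativeSemigroup Perm.++-commutativeMonoid)
    using (interchange)

concatMap-++-↭ : {f g h : A → List B} {xs : List A} →
  All (λ x → f x ↭ g x ++ h x) xs →
  concatMap f xs ↭ concatMap g xs ++ concatMap h xs
concatMap-++-↭ []                                     = ↭-refl
concatMap-++-↭ {g = g} {h = h} {xs = x ∷ xs} (p ∷ ps) = ↭-trans
  (Perm.++⁺ p (concatMap-++-↭ ps))
  (++-interchange (g x) (h x) (concatMap g xs) (concatMap h xs))

if-↭ : ∀ b {xs ys : List A} → xs ↭ ys →
  (if b then xs else []) ↭ (if b then ys else [])
if-↭ true  p = p
if-↭ false _ = ↭-refl

-- Refinements described letter by letter.

Letter : Set a → Set a
Letter A = Origin × A

-- The value `false` at the end of the list prevents a double count: `attach x []` is again the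
-- single block `x`, which the cut already yields.
joins : Origin → List (Letter A) → Bool
joins p []            = false
joins p ((q , _) ∷ _) = glued p q

extend : Bool → A → List (Sentence A) → List (Sentence A)
extend b x Is =
  map ((x ∷ []) ∷_) Is ++ (if b then map (attach x) Is else [])

-- The refinements of glue cs, by recursion on cs: see refinements-glue.
gluings : List (Letter A) → List (Sentence A)
gluings []             = [] ∷ []
gluings ((p , x) ∷ cs) = extend (joins p cs) x (gluings cs)

attach≢[] : (x : A) (I : Sentence A) → attach x I ≢ []
attach≢[] x []      ()
attach≢[] x (_ ∷ _) ()

gluings-∷-≢[] : (c : Letter A) (cs : List (Letter A)) →
  All (_≢ []) (gluings (c ∷ cs))
gluings-∷-≢[] (p , x) cs = All.++⁺
  (All.map⁺ (All.universal (λ _ ()) (gluings cs)))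
  (attached (joins p cs))
  where
  attached : ∀ b → All (_≢ []) (if b then map (attach x) (gluings cs) else [])
  attached true  = All.map⁺ (All.universal (attach≢[] x) (gluings cs))
  attached false = []

-- If attaching is allowed then a letter follows, so the degenerate case `attach x []`, which opens
-- a new word, does not arise. There `refinements-attach`, `attach-∗ˡ` and `∗ʳ-attach` would fail.
gluings-≢[] : ∀ p (cs : List (Letter A)) → T (joins p cs) →
  All (_≢ []) (gluings cs)
gluings-≢[] p (c ∷ cs) _ = gluings-∷-≢[] c cs

splits-≢[] : (x : A) (xs : List A) → All (_≢ []) (splits x xs)
splits-≢[] x []       = (λ ()) ∷ []
splits-≢[] x (y ∷ ys) = All.++⁺
  (All.map⁺ (All.universal (λ _ ()) (splits y ys)))
  (All.map⁺ (All.universal (attach≢[] x) (splits y ys)))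

product-map : (f : Sentence A → Sentence A) (Is Js : List (Sentence A)) →
  All (λ I → ∀ J → f I ++ J ≡ f (I ++ J)) Is →
  cartesianProductWith _++_ (map f Is) Js ≡
  map f (cartesianProductWith _++_ Is Js)
product-map f []       Js []       = refl
product-map f (I ∷ Is) Js (p ∷ ps) = begin
  map (f I ++_) Js ++ cartesianProductWith _++_ (map f Is) Js
    ≡⟨ cong₂ _++_ (≡-trans (List.map-cong p Js) (List.map-∘ Js)) (product-map f Is Js ps) ⟩
  map f (map (I ++_) Js) ++ map f (cartesianProductWith _++_ Is Js)
    ≡⟨ List.map-++ f (map (I ++_) Js) _ ⟨
  map f (map (I ++_) Js ++ cartesianProductWith _++_ Is Js) ∎
  where open ≡-Reasoning

-- The first word of `attach x I` has at least two letters, so `splits` offers the choice between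
-- cutting and joining after `x`. This choice distributes over the product with the refinements of
-- the later words.
refinements-attach : (x : A) (I : Sentence A) → I ≢ [] →
  refinements (attach x I) ≡ extend true x (refinements I)
refinements-attach x []             I≢[] with () ← I≢[] refl
refinements-attach x ((y ∷ ys) ∷ I) _ = ≡-trans
  (List.cartesianProductWith-distribʳ-++ _++_
    (map ((x ∷ []) ∷_) S) (map (attach x) S) (refinements I))
  (cong₂ _++_
    (product-map ((x ∷ []) ∷_) S (refinements I) (All.universal (λ _ _ → refl) S))
    (product-map (attach x) S (refinements I)
      (All.map attach-++ (splits-≢[] y ys))))
  where
  S = splits y ys

  attach-++ : ∀ {J} → J ≢ [] → ∀ K → attach x J ++ K ≡ attach x (J ++ K)
  attach-++ {[]}    J≢[] with () ← J≢[] refl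
  attach-++ {_ ∷ _} _ _ = refl

glue-∷ : ∀ p (x : A) cs →
  glue ((p , x) ∷ cs) ≡ (if joins p cs then attach x (glue cs) else (x ∷ []) ∷ glue cs)
glue-∷ p x []      = refl
glue-∷ p x (_ ∷ _) = refl

glue-≢[] : ∀ p (cs : List (Letter A)) → T (joins p cs) → glue cs ≢ []
glue-≢[] p ((q , x) ∷ cs) _ rewrite glue-∷ q x cs with joins q cs
... | true  = attach≢[] x (glue cs)
... | false = λ ()

-- A letter joined to its successor is handled by `refinements-attach`. Otherwise it is a one-letter
-- word, which has no proper refinement, and both sides compute to the same list.
refinements-glue : (cs : List (Letter A)) → refinements (glue cs) ≡ gluings cs
refinements-glue []             = refl
refinements-glue ((p , x) ∷ cs) = ≡-trans
  (cong refinements (glue-∷ p x cs))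
  (≡-trans
    (refinements-step (joins p cs) (glue-≢[] p cs))
    (cong (extend (joins p cs) x) (refinements-glue cs)))
  where
  refinements-step : ∀ b → (T b → glue cs ≢ []) →
    refinements (if b then attach x (glue cs) else (x ∷ []) ∷ glue cs) ≡
    extend b x (refinements (glue cs))
  refinements-step true  ne = refinements-attach x (glue cs) (ne _)
  refinements-step false _  = refl

glue-word : ∀ p → glued p p ≡ true → ∀ (x : A) xs cs → joins p cs ≡ false →
  glue (map (p ,_) (x ∷ xs) ++ cs) ≡ (x ∷ xs) ∷ glue cs
glue-word p p-p x []       cs p-cs rewrite glue-∷ p x cs | p-cs = refl
glue-word p p-p x (y ∷ ys) cs p-cs rewrite p-p | glue-word p p-p y ys cs p-cs = refl

n≡ᵇn : ∀ n → (n ≡ᵇ n) ≡ true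
n≡ᵇn zero    = refl
n≡ᵇn (suc n) = n≡ᵇn n

n≡ᵇ1+n : ∀ n → (n ≡ᵇ suc n) ≡ false
n≡ᵇ1+n zero    = refl
n≡ᵇ1+n (suc n) = n≡ᵇ1+n n

-- Abstracting `f` covers both factors at once, since within one factor gluing compares word
-- indices. Consecutive words have different indices, so each word is recovered whole.
glue-indexedLetters : (f : ℕ → Origin) → (∀ i j → glued (f i) (f j) ≡ (i ≡ᵇ j)) →
  ∀ k (I : Sentence A) → glue (map (map₁ f) (indexedLetters k I)) ≡ I
glue-indexedLetters f f-glued k []             = refl
glue-indexedLetters f f-glued k ((x ∷ xs) ∷ I) = begin
  glue (map (map₁ f) (map (k ,_) (x ∷ xs) ++ indexedLetters (suc k) I))
    ≡⟨ cong glue (List.map-++ (map₁ f) (map (k ,_) (x ∷ xs)) _) ⟩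
  glue (map (map₁ f) (map (k ,_) (x ∷ xs)) ++ cs)
    ≡⟨ cong (λ ds → glue (ds ++ cs)) (List.map-∘ (x ∷ xs)) ⟨
  glue (map (f k ,_) (x ∷ xs) ++ cs)
    ≡⟨ glue-word (f k) (≡-trans (f-glued k k) (n≡ᵇn k)) x xs cs (separated I) ⟩
  (x ∷ xs) ∷ glue cs
    ≡⟨ cong ((x ∷ xs) ∷_) (glue-indexedLetters f f-glued (suc k) I) ⟩
  (x ∷ xs) ∷ I ∎
  where
  open ≡-Reasoning
  cs = map (map₁ f) (indexedLetters (suc k) I)

  -- Words are non-empty, so the next letter, if there is one, carries exactly the index `suc k`.
  separated : ∀ I → joins (f k) (map (map₁ f) (indexedLetters (suc k) I)) ≡ false
  separated []            = refl
  separated ((_ ∷ _) ∷ _) = ≡-trans (f-glued k (suc k)) (n≡ᵇ1+n k)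

-- The quasi-shuffle split by the origin of the first letter.

bilinear : (A → B → List C) → List A → List B → List C
bilinear _∙_ xs ys = concatMap (λ x → concatMap (x ∙_) ys) xs

infixl 7 _∗ˡ_ _∗ʳ_

-- The terms of the quasi-shuffle whose first letter comes from the left,
-- respectively right, factor.
_∗ˡ_ : Sentence A → Sentence A → List (Sentence A)
[]      ∗ˡ J       = []
(u ∷ I) ∗ˡ []      = map (u ∷_) (I ∗ [])
(u ∷ I) ∗ˡ (v ∷ J) = map (u ∷_) (I ∗ (v ∷ J)) ++ map ((u ⁺++⁺ v) ∷_) (I ∗ J)

_∗ʳ_ : Sentence A → Sentence A → List (Sentence A)
I ∗ʳ []      = []
I ∗ʳ (v ∷ J) = map (v ∷_) (I ∗ J)

∗-identityʳ : (I : Sentence A) → I ∗ [] ≡ I ∷ []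
∗-identityʳ []      = refl
∗-identityʳ (_ ∷ _) = refl

-- The only term of `[] ∗ []` has no first letter, so some factor must be non-empty. The terms with
-- a merged block come last in `_∗_` and are moved next to those beginning with `u`, hence a
-- permutation.
∗-splitˡ : {I : Sentence A} → I ≢ [] → ∀ J → I ∗ J ↭ I ∗ˡ J ++ I ∗ʳ J
∗-splitˡ {I = []}    I≢[] J with () ← I≢[] refl
∗-splitˡ {I = u ∷ I} _ []      rewrite ∗-identityʳ I = ↭-refl
∗-splitˡ {I = u ∷ I} _ (v ∷ J) = begin
  x ++ y ++ z   ↭⟨ Perm.++⁺ˡ x (Perm.++-comm y z) ⟩
  x ++ z ++ y   ≡⟨ List.++-assoc x z y ⟨
  (x ++ z) ++ y ∎
  where
  open PermutationReasoning
  x = map (u ∷_) (I ∗ (v ∷ J))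
  y = map (v ∷_) ((u ∷ I) ∗ J)
  z = map ((u ⁺++⁺ v) ∷_) (I ∗ J)

∗-splitʳ : (I : Sentence A) → ∀ {J} → J ≢ [] → I ∗ J ↭ I ∗ˡ J ++ I ∗ʳ J
∗-splitʳ []      {[]}    J≢[] with () ← J≢[] refl
∗-splitʳ []      {_ ∷ _} _    = ↭-refl
∗-splitʳ (_ ∷ _) {J}     _    = ∗-splitˡ (λ ()) J

bilinear-∗-split : {Is Js : List (Sentence A)} →
  All (λ I → All (λ J → I ∗ J ↭ I ∗ˡ J ++ I ∗ʳ J) Js) Is →
  bilinear _∗_ Is Js ↭ bilinear _∗ˡ_ Is Js ++ bilinear _∗ʳ_ Is Js
bilinear-∗-split ps = concatMap-++-↭ (All.map concatMap-++-↭ ps)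

map-bilinear : (f : C → C) (_∙_ : A → B → List C) (xs : List A) (ys : List B) →
  map f (bilinear _∙_ xs ys) ≡ bilinear (λ x y → map f (x ∙ y)) xs ys
map-bilinear f _∙_ xs ys = ≡-trans
  (List.map-concatMap f (λ x → concatMap (x ∙_) ys) xs)
  (List.concatMap-cong (λ x → List.map-concatMap f (x ∙_) ys) xs)

-- Merging the block `x` with the first block `v` of `J` attaches `x` to a term of `I ∗ʳ J`. This is
-- why a letter of the left factor may be joined to any following letter of the right one.
singleton-∗ˡ : (x : A) (I J : Sentence A) →
  ((x ∷ []) ∷ I) ∗ˡ J ≡ map ((x ∷ []) ∷_) (I ∗ J) ++ map (attach x) (I ∗ʳ J)
singleton-∗ˡ x I []      = sym (List.++-identityʳ _)
singleton-∗ˡ x I (v ∷ J) = cong (map ((x ∷ []) ∷_) (I ∗ (v ∷ J)) ++_) (List.map-∘ (I ∗ J))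

attach-∗ˡ : (x : A) {I : Sentence A} → I ≢ [] → ∀ J →
  attach x I ∗ˡ J ≡ map (attach x) (I ∗ˡ J)
attach-∗ˡ x {[]}    I≢[] J with () ← I≢[] refl
attach-∗ˡ x {u ∷ I} _ []      = List.map-∘ (I ∗ [])
attach-∗ˡ x {u ∷ I} _ (v ∷ J) = ≡-trans
  (cong₂ _++_ (List.map-∘ (I ∗ (v ∷ J))) (List.map-∘ (I ∗ J)))
  (sym (List.map-++ (attach x) (map (u ∷_) (I ∗ (v ∷ J))) _))

∗ʳ-attach : (y : A) (I : Sentence A) {J : Sentence A} → J ≢ [] →
  I ∗ʳ attach y J ≡ map (attach y) (I ∗ʳ J)
∗ʳ-attach y I {[]}    J≢[] with () ← J≢[] refl
∗ʳ-attach y I {v ∷ J} _    = List.map-∘ (I ∗ J)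

-- Attachments to terms starting in the right factor come from merging with the separate block `x`,
-- so they occur for every `b`. Attachments to terms starting in the left factor come from
-- `attach x` inside the left factor and depend on `b`.
bilinear-extend-∗ˡ : ∀ b (x : A) (Is Js : List (Sentence A)) →
  (T b → All (_≢ []) Is) →
  bilinear _∗ˡ_ (extend b x Is) Js ↭
  map ((x ∷ []) ∷_) (bilinear _∗_ Is Js) ++
  map (attach x) (bilinear _∗ʳ_ Is Js ++
    (if b then bilinear _∗ˡ_ Is Js else []))
bilinear-extend-∗ˡ b x Is Js Is≢[] = begin
  bilinear _∗ˡ_ (extend b x Is) Js
    ≡⟨ List.concatMap-++ _ (map s Is) _ ⟩
  bilinear _∗ˡ_ (map s Is) Js ++
  bilinear _∗ˡ_ (if b then map t Is else []) Js
    ↭⟨ Perm.++⁺ singletons (↭-reflexive (attached b Is≢[])) ⟩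
  (map s P ++ map t R) ++ map t (if b then L else [])
    ≡⟨ List.++-assoc (map s P) (map t R) _ ⟩
  map s P ++ map t R ++ map t (if b then L else [])
    ≡⟨ cong (map s P ++_) (List.map-++ t R _) ⟨
  map s P ++ map t (R ++ (if b then L else [])) ∎
  where
  open PermutationReasoning
  s = (x ∷ []) ∷_
  t = attach x
  P = bilinear _∗_ Is Js
  L = bilinear _∗ˡ_ Is Js
  R = bilinear _∗ʳ_ Is Js

  singletons : bilinear _∗ˡ_ (map s Is) Js ↭ map s P ++ map t R
  singletons = begin
    bilinear _∗ˡ_ (map s Is) Js
      ≡⟨ List.concatMap-map _ s Is ⟩
    bilinear (λ I J → s I ∗ˡ J) Is Js
      ↭⟨ concatMap-++-↭ (All.universal (λ I → concatMap-++-↭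
           (All.universal (λ J → ↭-reflexive (singleton-∗ˡ x I J)) Js)) Is) ⟩
    bilinear (λ I J → map s (I ∗ J)) Is Js ++ bilinear (λ I J → map t (I ∗ʳ J)) Is Js
      ≡⟨ cong₂ _++_ (map-bilinear s _∗_ Is Js) (map-bilinear t _∗ʳ_ Is Js) ⟨
    map s P ++ map t R ∎

  attached : ∀ b → (T b → All (_≢ []) Is) →
    bilinear _∗ˡ_ (if b then map t Is else []) Js ≡ map t (if b then L else [])
  attached false _  = refl
  attached true  ne = ≡-trans
    (List.concatMap-map _ t Is)
    (≡-trans
      (cong concat (List.map-cong-local (All.map
        (λ I≢[] → List.concatMap-cong (attach-∗ˡ x I≢[]) Js) (ne _))))
      (sym (map-bilinear t _∗ˡ_ Is Js)))

-- A merged block always starts in the left factor, so `y` is never attached to a term starting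
-- there, and every attachment depends on `b`.
bilinear-∗ʳ-extend : ∀ b (y : A) (Is Js : List (Sentence A)) →
  (T b → All (_≢ []) Js) →
  bilinear _∗ʳ_ Is (extend b y Js) ↭
  map ((y ∷ []) ∷_) (bilinear _∗_ Is Js) ++
  map (attach y) (if b then bilinear _∗ʳ_ Is Js else [])
bilinear-∗ʳ-extend b y Is Js Js≢[] = begin
  bilinear _∗ʳ_ Is (extend b y Js)
    ↭⟨ concatMap-++-↭ (All.universal (λ I →
         ↭-reflexive (List.concatMap-++ (I ∗ʳ_) (map s Js) _)) Is) ⟩
  bilinear _∗ʳ_ Is (map s Js) ++
  bilinear _∗ʳ_ Is (if b then map t Js else [])
    ≡⟨ cong₂ _++_ singletons (attached b Js≢[]) ⟩
  map s P ++ map t (if b then R else []) ∎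
  where
  open PermutationReasoning
  s = (y ∷ []) ∷_
  t = attach y
  P = bilinear _∗_ Is Js
  R = bilinear _∗ʳ_ Is Js

  singletons : bilinear _∗ʳ_ Is (map s Js) ≡ map s P
  singletons = ≡-trans
    (List.concatMap-cong (λ I → List.concatMap-map (I ∗ʳ_) s Js) Is)
    (sym (map-bilinear s _∗_ Is Js))

  attached : ∀ b → (T b → All (_≢ []) Js) →
    bilinear _∗ʳ_ Is (if b then map t Js else []) ≡ map t (if b then R else [])
  attached false _  = concatMap-[] Is
  attached true  ne = ≡-trans
    (List.concatMap-cong (λ I → ≡-trans
      (List.concatMap-map (I ∗ʳ_) t Js)
      (cong concat (List.map-cong-local (All.map (∗ʳ-attach y I) (ne _))))) Is)
    (sym (map-bilinear t _∗ʳ_ Is Js))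

-- Interleavings and their gluings.

interleavingsˡ : List A → List A → List (List A)
interleavingsˡ []       ys = []
interleavingsˡ (x ∷ xs) ys = map (x ∷_) (interleavings xs ys)

interleavingsʳ : List A → List A → List (List A)
interleavingsʳ xs []       = []
interleavingsʳ xs (y ∷ ys) = map (y ∷_) (interleavings xs ys)

interleavings-identityʳ : (xs : List A) → interleavings xs [] ≡ xs ∷ []
interleavings-identityʳ []      = refl
interleavings-identityʳ (_ ∷ _) = refl

interleavings-splitˡ : (x : A) (xs ys : List A) →
  interleavings (x ∷ xs) ys ≡ interleavingsˡ (x ∷ xs) ys ++ interleavingsʳ (x ∷ xs) ys
interleavings-splitˡ x xs []      rewrite interleavings-identityʳ xs = refl
interleavings-splitˡ x xs (_ ∷ _) = refl

gluingsOf : List (List (Letter A)) → List (Sentence A)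
gluingsOf = concatMap gluings

gluingsAfter : Origin → List (List (Letter A)) → List (Sentence A)
gluingsAfter p = concatMap λ cs → if joins p cs then gluings cs else []

gluingsOf-∷ : ∀ p (x : A) (css : List (List (Letter A))) →
  gluingsOf (map ((p , x) ∷_) css) ↭
  map ((x ∷ []) ∷_) (gluingsOf css) ++ map (attach x) (gluingsAfter p css)
gluingsOf-∷ p x css = begin
  gluingsOf (map ((p , x) ∷_) css)
    ≡⟨ List.concatMap-map gluings ((p , x) ∷_) css ⟩
  concatMap (λ cs → gluings ((p , x) ∷ cs)) css
    ↭⟨ concatMap-++-↭ (All.universal (λ cs → Perm.++⁺ˡ _
         (↭-reflexive (sym (if-float (map (attach x)) (joins p cs))))) css) ⟩
  concatMap (λ cs → map ((x ∷ []) ∷_) (gluings cs)) css ++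
  concatMap (λ cs → map (attach x) (if joins p cs then gluings cs else [])) css
    ≡⟨ cong₂ _++_ (List.map-concatMap _ gluings css) (List.map-concatMap _ _ css) ⟨
  map ((x ∷ []) ∷_) (gluingsOf css) ++ map (attach x) (gluingsAfter p css) ∎
  where open PermutationReasoning

-- All the lists share the first letter `c`, so one test decides for all of them.
gluingsAfter-∷ : ∀ p (c : Letter A) (css : List (List (Letter A))) →
  gluingsAfter p (map (c ∷_) css) ≡
  (if glued p (proj₁ c) then gluingsOf (map (c ∷_) css) else [])
gluingsAfter-∷ p c css = ≡-trans
  (List.concatMap-map _ (c ∷_) css)
  (helper (glued p (proj₁ c)))
  where
  helper : ∀ b → concatMap (λ cs → if b then gluings (c ∷ cs) else []) css ≡
    (if b then gluingsOf (map (c ∷_) css) else [])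
  helper true  = sym (List.concatMap-map gluings (c ∷_) css)
  helper false = concatMap-[] css

-- The common recursion of the product and the fundamental shuffle.

module _ {A : Set a} where

  left right : List (ℕ × A) → List (Letter A)
  left  = map (map₁ inj₁)
  right = map (map₁ inj₂)

  -- Interleavings that take their first letter from the same side begin with the same letter, so
  -- one test per side suffices.
  gluingsAfter-interleavings : ∀ p is js →
    gluingsAfter p (interleavings (left is) (right js)) ≡
    (if joins p (left is) then gluingsOf (interleavingsˡ (left is) (right js)) else []) ++
    (if joins p (right js) then gluingsOf (interleavingsʳ (left is) (right js)) else [])
  gluingsAfter-interleavings p []       []       = refl
  gluingsAfter-interleavings p []       (j ∷ js) = gluingsAfter-∷ p _ (right js ∷ [])
  gluingsAfter-interleavings p (i ∷ is) js       = begin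
    gluingsAfter p (interleavings (left (i ∷ is)) (right js))
      ≡⟨ cong (gluingsAfter p) (interleavings-splitˡ _ (left is) (right js)) ⟩
    gluingsAfter p (interleavingsˡ (left (i ∷ is)) (right js) ++
                    interleavingsʳ (left (i ∷ is)) (right js))
      ≡⟨ List.concatMap-++ _ (interleavingsˡ (left (i ∷ is)) (right js)) _ ⟩
    gluingsAfter p (interleavingsˡ (left (i ∷ is)) (right js)) ++
    gluingsAfter p (interleavingsʳ (left (i ∷ is)) (right js))
      ≡⟨ cong₂ _++_ (gluingsAfter-∷ p _ (interleavings (left is) (right js))) (fromRight js) ⟩
    _ ∎
    where
    open ≡-Reasoning
    fromRight : ∀ js → gluingsAfter p (interleavingsʳ (left (i ∷ is)) (right js)) ≡
      (if joins p (right js)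
       then gluingsOf (interleavingsʳ (left (i ∷ is)) (right js)) else [])
    fromRight []       = refl
    fromRight (j ∷ js) = gluingsAfter-∷ p _ (interleavings (left (i ∷ is)) (right js))

  -- `glued (inj₁ i) (inj₂ j)` is always `true`, so terms starting on the right enter without a
  -- test. For empty `js` there are none, in agreement with the value of `joins` at `[]`.
  gluingsAfterˡ : ∀ i is js →
    gluingsAfter (inj₁ i) (interleavings (left is) (right js)) ↭
    gluingsOf (interleavingsʳ (left is) (right js)) ++
    (if joins (inj₁ i) (left is)
     then gluingsOf (interleavingsˡ (left is) (right js)) else [])
  gluingsAfterˡ i is []       = ↭-reflexive
    (≡-trans (gluingsAfter-interleavings (inj₁ i) is []) (List.++-identityʳ _))
  gluingsAfterˡ i is (j ∷ js) = ↭-trans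
    (↭-reflexive (gluingsAfter-interleavings (inj₁ i) is (j ∷ js)))
    (Perm.++-comm _ (gluingsOf (interleavingsʳ (left is) (right (j ∷ js)))))

  -- Since `glued (inj₂ j) (inj₁ i)` is `false`, the terms starting on the left vanish. The cases on
  -- `is` let `joins` compute.
  gluingsAfterʳ : ∀ j is js →
    gluingsAfter (inj₂ j) (interleavings (left is) (right js)) ≡
    (if joins (inj₂ j) (right js)
     then gluingsOf (interleavingsʳ (left is) (right js)) else [])
  gluingsAfterʳ j []       js = gluingsAfter-interleavings (inj₂ j) [] js
  gluingsAfterʳ j (i ∷ is) js = gluingsAfter-interleavings (inj₂ j) (i ∷ is) js

  -- The three statements need a simultaneous recursion: attaching a letter treats the two one-sided
  -- sums differently, and the statement for the whole product does not separate them.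
  gluings-∗ : ∀ is js →
    bilinear _∗_ (gluings (left is)) (gluings (right js)) ↭
    gluingsOf (interleavings (left is) (right js))
  gluings-∗ˡ : ∀ is js →
    bilinear _∗ˡ_ (gluings (left is)) (gluings (right js)) ↭
    gluingsOf (interleavingsˡ (left is) (right js))
  gluings-∗ʳ : ∀ is js →
    bilinear _∗ʳ_ (gluings (left is)) (gluings (right js)) ↭
    gluingsOf (interleavingsʳ (left is) (right js))

  -- With no first letter neither splitting applies; both sides consist of the empty sentence alone.
  gluings-∗ []       []       = ↭-refl
  gluings-∗ []       (j ∷ js) = ↭-trans
    (bilinear-∗-split {Is = gluings (left [])}
      (All.map (∗-splitʳ []) (gluings-∷-≢[] _ (right js)) ∷ []))
    (Perm.++⁺ (gluings-∗ˡ [] (j ∷ js)) (gluings-∗ʳ [] (j ∷ js)))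
  gluings-∗ (i ∷ is) js       = begin
    bilinear _∗_ Is Js
      ↭⟨ bilinear-∗-split (All.map (λ I≢[] → All.universal (∗-splitˡ I≢[]) Js)
           (gluings-∷-≢[] _ (left is))) ⟩
    bilinear _∗ˡ_ Is Js ++ bilinear _∗ʳ_ Is Js
      ↭⟨ Perm.++⁺ (gluings-∗ˡ (i ∷ is) js) (gluings-∗ʳ (i ∷ is) js) ⟩
    gluingsOf (interleavingsˡ cs ds) ++ gluingsOf (interleavingsʳ cs ds)
      ≡⟨ List.concatMap-++ gluings (interleavingsˡ cs ds) _ ⟨
    gluingsOf (interleavingsˡ cs ds ++ interleavingsʳ cs ds)
      ≡⟨ cong gluingsOf (interleavings-splitˡ _ (left is) ds) ⟨
    gluingsOf (interleavings cs ds) ∎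
    where
    open PermutationReasoning
    cs = left (i ∷ is)
    ds = right js
    Is = gluings cs
    Js = gluings ds

  gluings-∗ˡ []             js = ↭-reflexive
    (≡-trans (List.++-identityʳ _) (concatMap-[] (gluings (right js))))
  gluings-∗ˡ ((i , x) ∷ is) js = begin
    bilinear _∗ˡ_ (extend g x Is) Js
      ↭⟨ bilinear-extend-∗ˡ g x Is Js (gluings-≢[] (inj₁ i) (left is)) ⟩
    map ((x ∷ []) ∷_) (bilinear _∗_ Is Js) ++
    map (attach x) (bilinear _∗ʳ_ Is Js ++ (if g then bilinear _∗ˡ_ Is Js else []))
      ↭⟨ Perm.++⁺ (Perm.map⁺ _ (gluings-∗ is js))
           (Perm.map⁺ _ (↭-trans
             (Perm.++⁺ (gluings-∗ʳ is js) (if-↭ g (gluings-∗ˡ is js)))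
             (↭-sym (gluingsAfterˡ i is js)))) ⟩
    map ((x ∷ []) ∷_) (gluingsOf css) ++ map (attach x) (gluingsAfter (inj₁ i) css)
      ↭⟨ gluingsOf-∷ (inj₁ i) x css ⟨
    gluingsOf (map ((inj₁ i , x) ∷_) css) ∎
    where
    open PermutationReasoning
    g   = joins (inj₁ i) (left is)
    Is  = gluings (left is)
    Js  = gluings (right js)
    css = interleavings (left is) (right js)

  gluings-∗ʳ is []             = ↭-reflexive (concatMap-[] (gluings (left is)))
  gluings-∗ʳ is ((j , y) ∷ js) = begin
    bilinear _∗ʳ_ Is (extend g y Js)
      ↭⟨ bilinear-∗ʳ-extend g y Is Js (gluings-≢[] (inj₂ j) (right js)) ⟩
    map ((y ∷ []) ∷_) (bilinear _∗_ Is Js) ++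
    map (attach y) (if g then bilinear _∗ʳ_ Is Js else [])
      ↭⟨ Perm.++⁺ (Perm.map⁺ _ (gluings-∗ is js))
           (Perm.map⁺ _ (↭-trans
             (if-↭ g (gluings-∗ʳ is js))
             (↭-reflexive (sym (gluingsAfterʳ j is js))))) ⟩
    map ((y ∷ []) ∷_) (gluingsOf css) ++ map (attach y) (gluingsAfter (inj₂ j) css)
      ↭⟨ gluingsOf-∷ (inj₂ j) y css ⟨
    gluingsOf (map ((inj₂ j , y) ∷_) css) ∎
    where
    open PermutationReasoning
    g   = joins (inj₂ j) (right js)
    Is  = gluings (left is)
    Js  = gluings (right js)
    css = interleavings (left is) (right js)

  -- Both factors are recovered from their indexed letters, so `gluings-∗` applies once
  -- `refinements-glue` has turned refinements into gluings.
  refinements-∗ : (I J : Sentence A) →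
    bilinear _∗_ (refinements I) (refinements J) ↭ concatMap refinements (I ⋆ J)
  refinements-∗ I J = begin
    bilinear _∗_ (refinements I) (refinements J)
      ≡⟨ cong₂ (bilinear _∗_)
           (unglue inj₁ (λ _ _ → refl) I) (unglue inj₂ (λ _ _ → refl) J) ⟩
    bilinear _∗_ (gluings (left (indexedLetters 0 I))) (gluings (right (indexedLetters 0 J)))
      ↭⟨ gluings-∗ (indexedLetters 0 I) (indexedLetters 0 J) ⟩
    gluingsOf css
      ≡⟨ List.concatMap-cong refinements-glue css ⟨
    concatMap (refinements ∘ glue) css
      ≡⟨ List.concatMap-map refinements glue css ⟨
    concatMap refinements (I ⋆ J) ∎
    where
    open PermutationReasoning
    css = interleavings (left (indexedLetters 0 I)) (right (indexedLetters 0 J))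

    unglue : (f : ℕ → Origin) → (∀ i j → glued (f i) (f j) ≡ (i ≡ᵇ j)) →
      (K : Sentence A) → refinements K ≡ gluings (map (map₁ f) (indexedLetters 0 K))
    unglue f f-glued K = ≡-trans
      (cong refinements (sym (glue-indexedLetters f f-glued 0 K)))
      (refinements-glue (map (map₁ f) (indexedLetters 0 K)))

-- From lists of terms to coefficients.

module _ {a c ℓ₁ ℓ₂ : Level} {A : Set a} {n : ℕ} (A↔Fin : A ↔ Fin n)
  (𝕜 : HeytingField c ℓ₁ ℓ₂) where

  open ColouredQSym A↔Fin 𝕜
  open HeytingField 𝕜 using (heytingCommutativeRing)
  open HeytingCommutativeRing heytingCommutativeRing using (commutativeRing)
  private module 𝕜 = CommutativeRing commutativeRing
  open CommutativeSemigroupProperties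
    (CommutativeMonoid.commutativeSemigroup 𝕜.+-commutativeMonoid)
    using (x∙yz≈y∙xz)
  open SetoidReasoning 𝕜.setoid

  coefficient-++ : ∀ x y K →
    coefficient (x ++ y) K 𝕜.≈ coefficient x K 𝕜.+ coefficient y K
  coefficient-++ []            y K = 𝕜.sym (𝕜.+-identityˡ _)
  coefficient-++ ((s , I) ∷ x) y K = 𝕜.trans
    (𝕜.+-congˡ (coefficient-++ x y K))
    (𝕜.sym (𝕜.+-assoc _ _ _))

  -- A coefficient is a sum over all terms, so reordering them is absorbed by commutativity and
  -- associativity of addition.
  ↭⇒≈ : ∀ {x y} → x ↭ y → x ≈ y
  ↭⇒≈ refl         K = 𝕜.refl
  ↭⇒≈ (prep _ p)   K = 𝕜.+-congˡ (↭⇒≈ p K)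
  ↭⇒≈ (swap _ _ p) K = 𝕜.trans
    (𝕜.+-congˡ (𝕜.+-congˡ (↭⇒≈ p K)))
    (x∙yz≈y∙xz _ _ _)
  ↭⇒≈ (trans p q)  K = 𝕜.trans (↭⇒≈ p K) (↭⇒≈ q K)

  ∑-cong : {X : Set b} (is : List X) {f g : X → QSym} →
    (∀ i → f i ≈ g i) → ∑ is f ≈ ∑ is g
  ∑-cong []       f≈g K = 𝕜.refl
  ∑-cong (i ∷ is) {f} {g} f≈g K = begin
    coefficient (f i ++ ∑ is f) K                  ≈⟨ coefficient-++ (f i) (∑ is f) K ⟩
    coefficient (f i) K 𝕜.+ coefficient (∑ is f) K ≈⟨ 𝕜.+-cong (f≈g i K) (∑-cong is f≈g K) ⟩
    coefficient (g i) K 𝕜.+ coefficient (∑ is g) K ≈⟨ coefficient-++ (g i) (∑ is g) K ⟨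
    coefficient (g i ++ ∑ is g) K                  ∎

  -- The scalar is only required to equal one up to `≈`, because the product of two basis elements
  -- carries the factor `1# * 1#`.
  •-identityˡ : ∀ {s} → s 𝕜.≈ 𝕜.1# → ∀ x → s • x ≈ x
  •-identityˡ s≈1 []            K = 𝕜.refl
  •-identityˡ s≈1 ((t , I) ∷ x) K =
    𝕜.+-cong (scale (does (I ≟ K))) (•-identityˡ s≈1 x K)
    where
    scale : ∀ b → (if b then _ 𝕜.* t else 𝕜.0#) 𝕜.≈ (if b then t else 𝕜.0#)
    scale true  = 𝕜.trans (𝕜.*-congʳ s≈1) (𝕜.*-identityˡ t)
    scale false = 𝕜.refl

  ∑-M : (Is : List (Sentence A)) (f : 𝕜.Carrier × Sentence A → QSym) →
    ∑ (∑ Is M) f ≡ ∑ Is (λ I → f (𝕜.1# , I))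
  ∑-M Is f = ≡-trans
    (concatMap-concatMap f M Is)
    (List.concatMap-cong (λ _ → List.++-identityʳ _) Is)

  ∑M-·-∑M : (Is Js : List (Sentence A)) → ∑ Is M · ∑ Js M ≈ ∑ (bilinear _∗_ Is Js) M
  ∑M-·-∑M Is Js K = begin
    coefficient (∑ Is M · ∑ Js M) K
      ≡⟨ cong (λ x → coefficient x K) (≡-trans (∑-M Is _)
           (List.concatMap-cong (λ _ → ∑-M Js _) Is)) ⟩
    coefficient (∑ Is λ I → ∑ Js λ J → (𝕜.1# 𝕜.* 𝕜.1#) • ∑ (I ∗ J) M) K
      ≈⟨ ∑-cong Is (λ I → ∑-cong Js λ J →
           •-identityˡ (𝕜.*-identityˡ 𝕜.1#) (∑ (I ∗ J) M)) K ⟩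
    coefficient (∑ Is λ I → ∑ Js λ J → ∑ (I ∗ J) M) K
      ≡⟨ cong (λ x → coefficient x K) (≡-trans
           (concatMap-concatMap M _ Is)
           (List.concatMap-cong (λ I → concatMap-concatMap M (I ∗_) Js) Is)) ⟨
    coefficient (∑ (bilinear _∗_ Is Js) M) K ∎

  ∑M-↭ : {Is Js : List (Sentence A)} → Is ↭ Js → ∑ Is M ↭ ∑ Js M
  ∑M-↭ refl         = refl
  ∑M-↭ (prep _ p)   = prep _ (∑M-↭ p)
  ∑M-↭ (swap _ _ p) = swap _ _ (∑M-↭ p)
  ∑M-↭ (trans p q)  = trans (∑M-↭ p) (∑M-↭ q)

  F-·-F : (I J : Sentence A) → F I · F J ≈ ∑ (I ⋆ J) F
  F-·-F I J K = begin
    coefficient (F I · F J) K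
      ≈⟨ ∑M-·-∑M (refinements I) (refinements J) K ⟩
    coefficient (∑ (bilinear _∗_ (refinements I) (refinements J)) M) K
      ≈⟨ ↭⇒≈ (∑M-↭ (refinements-∗ I J)) K ⟩
    coefficient (∑ (concatMap refinements (I ⋆ J)) M) K
      -- `F` unfolds to a sum of `M` over refinements, so only the nesting of the two sums differs.
      ≡⟨ cong (λ x → coefficient x K) (concatMap-concatMap M refinements (I ⋆ J)) ⟩
    coefficient (∑ (I ⋆ J) F) K ∎

proposition5p2 : {a c ℓ₁ ℓ₂ : Level} {A : Set a} {n : ℕ} (A↔Fin : A ↔ Fin n)
    (𝕜 : HeytingField c ℓ₁ ℓ₂) → CharacteristicZero 𝕜 →
    let open ColouredQSym A↔Fin 𝕜 in
    (I J : Sentence A) → F I · F J ≈ ∑ (I ⋆ J) F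
proposition5p2 A↔Fin 𝕜 _ = F-·-F A↔Fin 𝕜
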